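{- Let $\Sigma=(G,\sigma)$ be a signed graph whose underlying graph $G$ is $2$-connected and non-geodetic. Then $\Sigma$ is incompatible if and only if $\Sigma$ contains a negative cycle $C_{2k}$ of even length $2k$ having two diametrically opposite vertices $u$ and $v$ (i.e., at distance $k$ along the cycle) such that there is no $u$–$v$ path in $G$ of length less than $k$.
   Context: All graphs are simple, finite and connected. A signed graph is $\Sigma=(G,\sigma)$ with $G=(V,E)$ and $\sigma:E\to\{1,-1\}$. The sign of a path or cycle is the product of the signs of its edges; a cycle is negative if its sign is $-1$. For vertices $u,v$, $d(u,v)$ is the usual distance in $G$ and $\mathcal{P}_{(u,v)}$ is the set of all shortest $u$–$v$ paths. Define $d_{\max}(u,v)=\max\{\sigma(P):P\in\mathcal{P}_{(u,v)}\}\,d(u,v)$ and $d_{\min}(u,v)=\min\{\sigma(P):P\in\mathcal{P}_{(u,v)}\}\,d(u,v)$. Vertices $u,v$ are compatible if $d_{\min}(u,v)=d_{\max}(u,v)$; $\Sigma$ is compatible if every pair of vertices is compatible, and incompatible otherwise. A graph is geodetic if every pair of vertices is joined by a unique shortest path; non-geodetic otherwise. -}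

module Defs where

open import Data.Nat as ℕ using (ℕ; zero; suc; _∸_)
open import Data.Integer as ℤ using (ℤ; _◃_)
open import Data.Sign as Sign using (Sign)
open import Data.Fin using (Fin)
open import Data.Bool using (Bool; true; false)
open import Data.List using (List; []; _∷_; length; head; last; drop)
open import Data.List.Relation.Unary.Unique.Propositional using (Unique)
open import Data.List.Membership.Propositional using (_∉_)
open import Data.Maybe using (Maybe; just; nothing)
open import Data.Product using (Σ; ∃; _×_; _,_)
open import Data.Unit using (⊤)
open import Relation.Binary.PropositionalEquality using (_≡_; _≢_)
open import Relation.Nullary using (¬_)

-- A finite simple graph on vertex set Fin n (adjacency as a symmetric,
-- irreflexive Boolean relation).
record Graph (n : ℕ) : Set where
  field
    adj    : Fin n → Fin n → Bool
    sym    : ∀ u v → adj u v ≡ adj v u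
    irrefl : ∀ u → adj u u ≡ false

-- A signed graph: a graph with a sign on every edge.  The sign function is
-- given on all pairs and is symmetric; its values on non-edges are irrelevant.
record SignedGraph (n : ℕ) : Set where
  field
    graph : Graph n
    σ     : Fin n → Fin n → Sign
    σ-sym : ∀ u v → σ u v ≡ σ v u
  open Graph graph public

-- Safe list indexing.
_!_ : ∀ {A : Set} → List A → ℕ → Maybe A
[]       ! _     = nothing
(x ∷ xs) ! zero  = just x
(x ∷ xs) ! suc i = xs ! i

module _ {n : ℕ} (Γ : SignedGraph n) where
  open SignedGraph Γ

  V : Set
  V = Fin n

  -- consecutive vertices of the list are adjacent
  Chain : List V → Set
  Chain []           = ⊤
  Chain (x ∷ [])     = ⊤
  Chain (x ∷ y ∷ xs) = (adj x y ≡ true) × Chain (y ∷ xs)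

  -- number of edges of a walk given as its vertex list
  len : List V → ℕ
  len xs = length xs ∸ 1

  -- sign of a walk: product of the signs of its edges
  signOf : List V → Sign
  signOf (x ∷ y ∷ xs) = σ x y Sign.* signOf (y ∷ xs)
  signOf _            = Sign.+

  -- a u–v path: a walk from u to v with pairwise distinct vertices
  IsPath : V → V → List V → Set
  IsPath u v p = (head p ≡ just u) × (last p ≡ just v) × Chain p × Unique p

  -- a shortest u–v path (element of 𝒫_(u,v))
  Shortest : V → V → List V → Set
  Shortest u v p = IsPath u v p × (∀ q → IsPath u v q → len p ℕ.≤ len q)

  -- d(u,v) = d
  IsDist : V → V → ℕ → Set
  IsDist u v d = Σ (List V) λ p → Shortest u v p × len p ≡ d

  signℤ : List V → ℤ
  signℤ p = signOf p ◃ 1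

  -- s = max { σ(P) : P ∈ 𝒫_(u,v) }
  IsMaxSign : V → V → ℤ → Set
  IsMaxSign u v s = (Σ (List V) λ p → Shortest u v p × s ≡ signℤ p)
                  × (∀ p → Shortest u v p → signℤ p ℤ.≤ s)

  -- s = min { σ(P) : P ∈ 𝒫_(u,v) }
  IsMinSign : V → V → ℤ → Set
  IsMinSign u v s = (Σ (List V) λ p → Shortest u v p × s ≡ signℤ p)
                  × (∀ p → Shortest u v p → s ℤ.≤ signℤ p)

  -- z = d_max(u,v)
  IsDmax : V → V → ℤ → Set
  IsDmax u v z = Σ ℤ λ s → Σ ℕ λ d → IsMaxSign u v s × IsDist u v d × z ≡ s ℤ.* ℤ.+ d

  -- z = d_min(u,v)
  IsDmin : V → V → ℤ → Set
  IsDmin u v z = Σ ℤ λ s → Σ ℕ λ d → IsMinSign u v s × IsDist u v d × z ≡ s ℤ.* ℤ.+ d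

  -- u, v compatible: d_min(u,v) = d_max(u,v)
  Compatible : V → V → Set
  Compatible u v = ∀ x y → IsDmax u v x → IsDmin u v y → x ≡ y

  -- Σ incompatible: some pair of vertices is not compatible
  Incompatible : Set
  Incompatible = ∃ λ u → ∃ λ v → ¬ Compatible u v

  Connected : Set
  Connected = ∀ u v → ∃ λ p → IsPath u v p

  -- 2-connected: at least 3 vertices, connected, and no cut vertex
  TwoConnected : Set
  TwoConnected = (3 ℕ.≤ n) × Connected
               × (∀ w u v → u ≢ w → v ≢ w → ∃ λ p → IsPath u v p × w ∉ p)

  -- some pair of vertices is joined by two distinct shortest paths
  NonGeodetic : Set
  NonGeodetic = ∃ λ u → ∃ λ v → ∃ λ p → ∃ λ q → Shortest u v p × Shortest u v q × p ≢ q

  -- a cycle, given as a closed walk v0 v1 ... v(m-1) v0 (list of length m+1)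
  -- with v0,...,v(m-1) pairwise distinct and m ≥ 3
  IsCycle : List V → Set
  IsCycle c = Chain c × (head c ≡ last c) × Unique (drop 1 c) × (3 ℕ.≤ len c)

  -- Σ contains a negative cycle C_{2k} with diametrically opposite vertices
  -- u = v_i and v = v_(i+k) such that no u–v path of G has length < k
  HasNegEvenCycleWithGeodesicDiameter : Set
  HasNegEvenCycleWithGeodesicDiameter =
    Σ (List V) λ c → Σ ℕ λ k → Σ V λ u → Σ V λ v → Σ ℕ λ i →
      IsCycle c × len c ≡ k ℕ.+ k × signOf c ≡ Sign.-
      × c ! i ≡ just u × c ! (i ℕ.+ k) ≡ just v
      × (∀ p → IsPath u v p → k ℕ.≤ len p)

{-# OPTIONS --safe #-}
-- Vertices u, v are incompatible exactly when two shortest u–v paths have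
-- opposite signs.  If two such paths share an inner vertex x, cutting both at x
-- gives halves that are again shortest paths, and since the signs factor through
-- x, one pair of halves still has opposite signs; so a shortest such pair is
-- internally disjoint, and it closes up into a negative cycle of length 2k whose
-- antipodes are at distance k.  Conversely, the two arcs of such a cycle between
-- its antipodes have length k, hence are shortest paths, and their signs multiply
-- to −1.
module Submission where

open import Data.Bool as Bool using (true)
open import Data.Fin as Fin using (Fin)
open import Data.Integer as ℤ using (_◃_)
open import Data.List using (List; []; _∷_; [_]; _++_; head; last; length; reverse; allFin; concatMap; map)
open import Data.List.Properties using (length-++; length-reverse; unfold-reverse)
open import Data.List.Membership.Propositional using (_∈_; find; lose)
open import Data.List.Membership.Propositional.Properties using (∈-∃++; ∈-map⁺; ∈-concatMap⁺; ∈-allFin)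
open import Data.List.Relation.Binary.Permutation.Propositional using (↭-sym; ↭⇒↭ₛ)
open import Data.List.Relation.Binary.Permutation.Propositional.Properties using (↭-reverse)
import Data.List.Relation.Binary.Permutation.Setoid.Properties as Permutationₛ
open import Data.List.Relation.Unary.All as All using ([])
open import Data.List.Relation.Unary.All.Properties using (¬Any⇒All¬)
open import Data.List.Relation.Unary.AllPairs as AllPairs using ([]; _∷_)
open import Data.List.Relation.Unary.Any as Any using (here; there)
open import Data.List.Relation.Unary.Any.Properties using (reverse⁻)
open import Data.List.Relation.Unary.Unique.Propositional using (Unique)
open import Data.List.Relation.Unary.Unique.Propositional.Properties using (++⁺)
open import Data.Maybe using (just)
import Data.Maybe.Properties as Maybe
open import Data.Nat using (ℕ; zero; suc; _+_; _∸_; _≤_; _<_; z≤n; s≤s)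
open import Data.Nat.Induction using (<-wellFounded)
open import Data.Nat.Properties
  using (≤-refl; ≤-trans; ≤-reflexive; ≤-antisym; <⇒≤; ≰⇒>; <⇒≱; _≤?_; +-comm; +-assoc; +-suc;
         +-cancelˡ-≡; +-cancelˡ-≤; +-cancelʳ-≤; m≤n+m; m<m+n; m<n+m; n≤1+n; +-mono-≤; ∸-monoˡ-≤;
         module ≤-Reasoning)
open import Data.Product using (∃; ∃₂; _×_; _,_; proj₁; proj₂)
open import Data.Sign as Sign using (Sign)
open import Data.Sign.Properties using (s*s≡+; *-comm; *-assoc; *-identityˡ; *-identityʳ)
open import Data.Sum as Sum using (_⊎_; inj₁; inj₂)
open import Data.Unit using (tt)
open import Function.Bundles using (_⇔_; mk⇔)
open import Induction.WellFounded using (Acc; acc)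
open import Relation.Binary.PropositionalEquality
  using (_≡_; _≢_; refl; sym; trans; cong; cong₂; subst; setoid; module ≡-Reasoning)
open import Relation.Nullary using (¬_; Dec; yes; no; ¬?; _×-dec_; _→-dec_; contradiction)

open import Defs

≢⇒*≡- : ∀ {s t} → s ≢ t → s Sign.* t ≡ Sign.-
≢⇒*≡- {Sign.-} {Sign.-} s≢t = contradiction refl s≢t
≢⇒*≡- {Sign.-} {Sign.+} _   = refl
≢⇒*≡- {Sign.+} {Sign.-} _   = refl
≢⇒*≡- {Sign.+} {Sign.+} s≢t = contradiction refl s≢t

*≡-⇒≢ : ∀ {s t} → s Sign.* t ≡ Sign.- → s ≢ t
*≡-⇒≢ {s} st≡- refl with () ← trans (sym (s*s≡+ s)) st≡-

≢-cases : ∀ {s t} → s ≢ t → (s ≡ Sign.+ × t ≡ Sign.-) ⊎ (s ≡ Sign.- × t ≡ Sign.+)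
≢-cases {Sign.-} {Sign.-} s≢t = contradiction refl s≢t
≢-cases {Sign.-} {Sign.+} _   = inj₂ (refl , refl)
≢-cases {Sign.+} {Sign.-} _   = inj₁ (refl , refl)
≢-cases {Sign.+} {Sign.+} s≢t = contradiction refl s≢t

*-rotate : ∀ r s t → r Sign.* (s Sign.* t) ≡ s Sign.* (t Sign.* r)
*-rotate r s t = trans (*-comm r (s Sign.* t)) (*-assoc s t r)

Unique-++⁻ʳ : ∀ {A : Set} (xs : List A) {ys} → Unique (xs ++ ys) → Unique ys
Unique-++⁻ʳ []       u       = u
Unique-++⁻ʳ (x ∷ xs) (_ ∷ u) = Unique-++⁻ʳ xs u

Unique-reverse : ∀ {A : Set} {xs : List A} → Unique xs → Unique (reverse xs)
Unique-reverse {A} {xs} =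
  Permutationₛ.Unique-resp-↭ (setoid A) (↭⇒↭ₛ (↭-sym (↭-reverse xs)))

!⇒++ : ∀ {A : Set} (xs : List A) {i x} → xs ! i ≡ just x →
       ∃₂ λ pre post → xs ≡ pre ++ x ∷ post × length pre ≡ i
!⇒++ (y ∷ xs) {zero}  refl = [] , xs , refl , refl
!⇒++ (y ∷ xs) {suc i} xs!i with pre , post , refl , refl ← !⇒++ xs xs!i =
  y ∷ pre , post , refl , refl

!-++ʳ : ∀ {A : Set} (pre : List A) {ys} j → (pre ++ ys) ! (length pre + j) ≡ ys ! j
!-++ʳ []        j = refl
!-++ʳ (x ∷ pre) j = !-++ʳ pre j

module _ {n : ℕ} (Γ : SignedGraph n) where
  open SignedGraph Γ using (adj; σ; σ-sym) renaming (sym to adj-sym)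
  open import Data.List.Membership.DecPropositional (Fin._≟_ {n}) using (_∈?_)

  private
    variable
      a b u v w x : Fin n
      p q pre post : List (Fin n)

  data Walk : Fin n → Fin n → List (Fin n) → Set where
    stop : ∀ x → Walk x x [ x ]
    step : ∀ {x y z xs} → adj x y ≡ true → Walk y z (y ∷ xs) → Walk x z (x ∷ y ∷ xs)

  walk⇒∷ : Walk u v p → ∃ λ t → p ≡ u ∷ t
  walk⇒∷ (stop _)   = [] , refl
  walk⇒∷ (step _ _) = _ , refl

  chain⇒walk : ∀ p → head p ≡ just u → last p ≡ just v → Chain Γ p → Walk u v p
  chain⇒walk (x ∷ [])     refl refl _       = stop x
  chain⇒walk (x ∷ y ∷ xs) refl l    (e , c) = step e (chain⇒walk (y ∷ xs) refl l c)

  walk⇒chain : Walk u v p → head p ≡ just u × last p ≡ just v × Chain Γ p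
  walk⇒chain (stop x) = refl , refl , tt
  walk⇒chain (step e ws) with refl , l , c ← walk⇒chain ws = refl , l , e , c

  path⇒walk : IsPath Γ u v p → Walk u v p
  path⇒walk {p = p} (h , l , c , _) = chain⇒walk p h l c

  unique-walk⇒path : Walk u v p → Unique p → IsPath Γ u v p
  unique-walk⇒path ws up with h , l , c ← walk⇒chain ws = h , l , c , up

  _++ʷ_ : Walk u v p → Walk v w (v ∷ q) → Walk u w (p ++ q)
  stop _     ++ʷ ws′ = ws′
  step e ws  ++ʷ ws′ = step e (ws ++ʷ ws′)

  len-++ʷ : Walk u v p → ∀ q → len Γ (p ++ q) ≡ len Γ p + length q
  len-++ʷ (stop _)    q = refl
  len-++ʷ (step _ ws) q = cong suc (len-++ʷ ws q)

  signOf-++ʷ : Walk u v p → ∀ q → signOf Γ (p ++ q) ≡ signOf Γ p Sign.* signOf Γ (v ∷ q)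
  signOf-++ʷ (stop _) q = sym (*-identityˡ _)
  signOf-++ʷ (step {x} {y} _ ws) q =
    trans (cong (σ x y Sign.*_) (signOf-++ʷ ws q)) (sym (*-assoc (σ x y) _ _))

  len-∷ʳ : ∀ pre → len Γ (pre ++ [ x ]) ≡ length pre
  len-∷ʳ pre = cong (_∸ 1) (trans (length-++ pre) (+-comm (length pre) 1))

  len-split : ∀ pre → len Γ (pre ++ x ∷ post) ≡ len Γ (pre ++ [ x ]) + len Γ (x ∷ post)
  len-split {x} {post} pre = begin
    length (pre ++ x ∷ post) ∸ 1          ≡⟨ cong (_∸ 1) (length-++ pre) ⟩
    (length pre + suc (length post)) ∸ 1  ≡⟨ cong (_∸ 1) (+-suc (length pre) _) ⟩
    length pre + length post              ≡⟨ cong (_+ length post) (len-∷ʳ pre) ⟨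
    len Γ (pre ++ [ x ]) + length post    ∎
    where open ≡-Reasoning

  signOf-split : ∀ pre → signOf Γ (pre ++ x ∷ post) ≡ signOf Γ (pre ++ [ x ]) Sign.* signOf Γ (x ∷ post)
  signOf-split []           = sym (*-identityˡ _)
  signOf-split {x} (y ∷ []) = cong (Sign._* _) (sym (*-identityʳ (σ y x)))
  signOf-split (y ∷ z ∷ pre) =
    trans (cong (σ y z Sign.*_) (signOf-split (z ∷ pre))) (sym (*-assoc (σ y z) _ _))

  split-walk : ∀ pre → Walk a b (pre ++ x ∷ post) → Walk a x (pre ++ [ x ]) × Walk x b (x ∷ post)
  split-walk []            (stop _)    = stop _ , stop _
  split-walk []            (step e ws) = stop _ , step e ws
  split-walk (y ∷ [])      (step e ws) = step e (stop _) , ws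
  split-walk (y ∷ z ∷ pre) (step e ws) with ws₁ , ws₂ ← split-walk (z ∷ pre) ws = step e ws₁ , ws₂

  reverseʷ : Walk u v p → Walk v u (reverse p)
  reverseʷ (stop x) = stop x
  reverseʷ (step {x} {y} {xs = xs} e ws) =
    subst (Walk _ x) (sym (unfold-reverse x (y ∷ xs)))
      (reverseʷ ws ++ʷ step (trans (adj-sym y x) e) (stop x))

  len-reverse : ∀ p → len Γ (reverse p) ≡ len Γ p
  len-reverse p = cong (_∸ 1) (length-reverse p)

  signOf-reverse : Walk u v p → signOf Γ (reverse p) ≡ signOf Γ p
  signOf-reverse (stop x) = refl
  signOf-reverse (step {x} {y} {xs = xs} e ws) = begin
    signOf Γ (reverse (x ∷ y ∷ xs))                        ≡⟨ cong (signOf Γ) (unfold-reverse x (y ∷ xs)) ⟩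
    signOf Γ (reverse (y ∷ xs) ++ [ x ])                   ≡⟨ signOf-++ʷ (reverseʷ ws) [ x ] ⟩
    signOf Γ (reverse (y ∷ xs)) Sign.* (σ y x Sign.* Sign.+) ≡⟨ cong₂ Sign._*_ (signOf-reverse ws) (*-identityʳ (σ y x)) ⟩
    signOf Γ (y ∷ xs) Sign.* σ y x                         ≡⟨ *-comm _ (σ y x) ⟩
    σ y x Sign.* signOf Γ (y ∷ xs)                         ≡⟨ cong (Sign._* signOf Γ (y ∷ xs)) (σ-sym y x) ⟩
    signOf Γ (x ∷ y ∷ xs)                                  ∎
    where open ≡-Reasoning

  !-len : Walk u v p → ∀ q → (p ++ q) ! len Γ p ≡ just v
  !-len (stop _)    q = refl
  !-len (step _ ws) q = !-len ws q

  0<len : Walk u v p → u ≢ v → 0 < len Γ p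
  0<len (stop _)   u≢u = contradiction refl u≢u
  0<len (step _ _) _   = s≤s z≤n

  ≤1-edge-walk-unique : Walk u v p → Walk u v q → len Γ p ≤ 1 → len Γ p ≡ len Γ q → p ≡ q
  ≤1-edge-walk-unique (stop _)           (stop _)           _ _ = refl
  ≤1-edge-walk-unique (step _ (stop _))  (step _ (stop _))  _ _ = refl
  ≤1-edge-walk-unique (step _ (step _ _)) _ (s≤s ()) _
  ≤1-edge-walk-unique (stop _) (step _ _) _ ()
  ≤1-edge-walk-unique (step _ (stop _)) (stop _) _ ()
  ≤1-edge-walk-unique (step _ (stop _)) (step _ (step _ _)) _ ()

  shortens⇒≤ : q ≡ p ⊎ len Γ q < len Γ p → len Γ q ≤ len Γ p
  shortens⇒≤ (inj₁ refl) = ≤-refl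
  shortens⇒≤ (inj₂ lt)   = <⇒≤ lt

  walk⇒shorter-path : Walk u v p → ∃ λ q → Walk u v q × Unique q × (q ≡ p ⊎ len Γ q < len Γ p)
  walk⇒shorter-path (stop x) = [ x ] , stop x , [] ∷ [] , inj₁ refl
  walk⇒shorter-path (step {x} e ws) with q , wq , uq , q≤ ← walk⇒shorter-path ws with x ∈? q
  ... | no x∉q with t , refl ← walk⇒∷ wq =
    x ∷ q , step e wq , ¬Any⇒All¬ _ x∉q ∷ uq , Sum.map (cong (x ∷_)) s≤s q≤
  ... | yes x∈q with pre , post , refl ← ∈-∃++ x∈q =
    x ∷ post , proj₂ (split-walk pre wq) , Unique-++⁻ʳ pre uq ,
    inj₂ (s≤s (≤-trans (m≤n+m _ _) (≤-trans (≤-reflexive (sym (len-split pre))) (shortens⇒≤ q≤))))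

  ShortestWalk : Fin n → Fin n → List (Fin n) → Set
  ShortestWalk u v p = Walk u v p × (∀ q → Walk u v q → len Γ p ≤ len Γ q)

  geodesic⇒shortest : Walk u v p → (∀ q → IsPath Γ u v q → len Γ p ≤ len Γ q) → Shortest Γ u v p
  geodesic⇒shortest wp geo with walk⇒shorter-path wp
  ... | _ , _ , up , inj₁ refl = unique-walk⇒path wp up , geo
  ... | q , wq , uq , inj₂ q<p = contradiction (geo q (unique-walk⇒path wq uq)) (<⇒≱ q<p)

  shortest⇒shortestWalk : Shortest Γ u v p → ShortestWalk u v p
  shortest⇒shortestWalk (path , minimal) = path⇒walk path , λ q wq →
    let r , wr , ur , r≤q = walk⇒shorter-path wq
    in  ≤-trans (minimal r (unique-walk⇒path wr ur)) (shortens⇒≤ r≤q)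

  shortestWalk⇒shortest : ShortestWalk u v p → Shortest Γ u v p
  shortestWalk⇒shortest (wp , minimal) = geodesic⇒shortest wp λ q path → minimal q (path⇒walk path)

  shortest-len : Shortest Γ u v p → Shortest Γ u v q → len Γ p ≡ len Γ q
  shortest-len (path-p , min-p) (path-q , min-q) = ≤-antisym (min-p _ path-q) (min-q _ path-p)

  shortestWalk-split : ∀ pre → ShortestWalk u v (pre ++ x ∷ post) →
                       ShortestWalk u x (pre ++ [ x ]) × ShortestWalk x v (x ∷ post)
  shortestWalk-split {v = v} {x = x} {post} pre (wp , minimal) with w₁ , w₂ ← split-walk pre wp =
    (w₁ , λ r wr → +-cancelʳ-≤ (length post) _ _ (begin
      len Γ (pre ++ [ x ]) + length post  ≡⟨ len-split pre ⟨
      len Γ (pre ++ x ∷ post)             ≤⟨ minimal _ (wr ++ʷ w₂) ⟩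
      len Γ (r ++ post)                   ≡⟨ len-++ʷ wr post ⟩
      len Γ r + length post               ∎)) ,
    (w₂ , second)
    where
    open ≤-Reasoning
    second : ∀ r → Walk x v r → len Γ (x ∷ post) ≤ len Γ r
    second r wr with t , refl ← walk⇒∷ wr = +-cancelˡ-≤ (len Γ (pre ++ [ x ])) _ _ (begin
      len Γ (pre ++ [ x ]) + length post  ≡⟨ len-split pre ⟨
      len Γ (pre ++ x ∷ post)             ≤⟨ minimal _ (w₁ ++ʷ wr) ⟩
      len Γ ((pre ++ [ x ]) ++ t)         ≡⟨ len-++ʷ w₁ t ⟩
      len Γ (pre ++ [ x ]) + length t     ∎)

  Discordant : Fin n → Fin n → List (Fin n) → List (Fin n) → Set
  Discordant u v p q = Shortest Γ u v p × Shortest Γ u v q × signOf Γ p ≢ signOf Γ q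

  InternallyDisjoint : Fin n → Fin n → List (Fin n) → List (Fin n) → Set
  InternallyDisjoint u v p q = ∀ {x} → x ∈ p → x ∈ q → x ≡ u ⊎ x ≡ v

  discordant-split : Discordant u v p q → x ∈ p → x ∈ q → x ≢ u → x ≢ v →
                     ∃₂ λ a b → ∃₂ λ p′ q′ → Discordant a b p′ q′ × len Γ p′ < len Γ p
  discordant-split {u} {v} {x = x} (sp , sq , p≢q) x∈p x∈q x≢u x≢v
    with pre , post , refl ← ∈-∃++ x∈p | pre′ , post′ , refl ← ∈-∃++ x∈q
    with sp₁ , sp₂ ← shortestWalk-split pre (shortest⇒shortestWalk sp)
       | sq₁ , sq₂ ← shortestWalk-split pre′ (shortest⇒shortestWalk sq)
    with signOf Γ (pre ++ [ x ]) Sign.≟ signOf Γ (pre′ ++ [ x ])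
  ... | no ≢₁ = u , x , _ , _ ,
    (shortestWalk⇒shortest sp₁ , shortestWalk⇒shortest sq₁ , ≢₁) ,
    subst (len Γ (pre ++ [ x ]) <_) (sym (len-split pre)) (m<m+n _ (0<len (proj₁ sp₂) x≢v))
  ... | yes ≡₁ = x , v , _ , _ ,
    (shortestWalk⇒shortest sp₂ , shortestWalk⇒shortest sq₂ , λ ≡₂ →
      p≢q (trans (signOf-split pre) (trans (cong₂ Sign._*_ ≡₁ ≡₂) (sym (signOf-split pre′))))) ,
    subst (len Γ (x ∷ post) <_) (sym (len-split pre)) (m<n+m _ (0<len (proj₁ sp₁) (λ u≡x → x≢u (sym u≡x))))

  discordant⇒2≤len : Discordant u v p q → 2 ≤ len Γ p
  discordant⇒2≤len {p = p} (sp@(path-p , _) , sq@(path-q , _) , p≢q) with len Γ p ≤? 1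
  ... | yes ≤1 = contradiction
    (cong (signOf Γ) (≤1-edge-walk-unique (path⇒walk path-p) (path⇒walk path-q) ≤1 (shortest-len sp sq))) p≢q
  ... | no  ≰1 = ≰⇒> ≰1

  disjoint-discordant⇒cycle : Discordant u v p q → InternallyDisjoint u v p q →
                              HasNegEvenCycleWithGeodesicDiameter Γ
  disjoint-discordant⇒cycle {u} {v} {p} {q} (sp@(path-p@(_ , _ , _ , unique-p) , _) , sq@(path-q , _) , p≢q) disjoint
    with t , refl ← walk⇒∷ (path⇒walk path-p)
    with r , r≡ ← walk⇒∷ (reverseʷ (path⇒walk path-q)) =
    p ++ r , len Γ p , u , v , 0 ,
    (proj₂ (proj₂ closed) , trans (proj₁ closed) (sym (proj₁ (proj₂ closed))) ,
     ++⁺ (AllPairs.tail unique-p) (AllPairs.tail unique-r) tails-disjoint , 3≤len) ,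
    len-cycle , negative , refl , !-len wp r , proj₂ sp
    where
    wp : Walk u v p
    wp = path⇒walk path-p
    wq : Walk u v q
    wq = path⇒walk path-q
    wr : Walk v u (v ∷ r)
    wr = subst (Walk v u) r≡ (reverseʷ wq)
    closed : head (p ++ r) ≡ just u × last (p ++ r) ≡ just u × Chain Γ (p ++ r)
    closed = walk⇒chain (wp ++ʷ wr)
    unique-r : Unique (v ∷ r)
    unique-r = subst Unique r≡ (Unique-reverse (proj₂ (proj₂ (proj₂ path-q))))
    tails-disjoint : ∀ {y} → ¬ (y ∈ t × y ∈ r)
    tails-disjoint {y} (y∈t , y∈r)
      with disjoint (there y∈t) (reverse⁻ (subst (y ∈_) (sym r≡) (there y∈r)))
    ... | inj₁ refl = All.lookup (AllPairs.head unique-p) y∈t refl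
    ... | inj₂ refl = All.lookup (AllPairs.head unique-r) y∈r refl
    len-cycle : len Γ (p ++ r) ≡ len Γ p + len Γ p
    len-cycle = begin
      len Γ (p ++ r)            ≡⟨ len-++ʷ wp r ⟩
      len Γ p + len Γ (v ∷ r)   ≡⟨ cong (λ s → len Γ p + len Γ s) r≡ ⟨
      len Γ p + len Γ (reverse q) ≡⟨ cong (len Γ p +_) (len-reverse q) ⟩
      len Γ p + len Γ q         ≡⟨ cong (len Γ p +_) (shortest-len sq sp) ⟩
      len Γ p + len Γ p         ∎
      where open ≡-Reasoning
    3≤len : 3 ≤ len Γ (p ++ r)
    3≤len = subst (3 ≤_) (sym len-cycle) (≤-trans (n≤1+n 3) (+-mono-≤ 2≤len 2≤len))
      where
      2≤len : 2 ≤ len Γ p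
      2≤len = discordant⇒2≤len (sp , sq , p≢q)
    negative : signOf Γ (p ++ r) ≡ Sign.-
    negative = begin
      signOf Γ (p ++ r)                       ≡⟨ signOf-++ʷ wp r ⟩
      signOf Γ p Sign.* signOf Γ (v ∷ r)      ≡⟨ cong (λ s → signOf Γ p Sign.* signOf Γ s) r≡ ⟨
      signOf Γ p Sign.* signOf Γ (reverse q)  ≡⟨ cong (signOf Γ p Sign.*_) (signOf-reverse wq) ⟩
      signOf Γ p Sign.* signOf Γ q            ≡⟨ ≢⇒*≡- p≢q ⟩
      Sign.-                                  ∎
      where open ≡-Reasoning

  discordant⇒cycle : Discordant u v p q → HasNegEvenCycleWithGeodesicDiameter Γ
  discordant⇒cycle = descend (<-wellFounded _)
    where
    descend : ∀ {u v p q} → Acc _<_ (len Γ p) → Discordant u v p q → HasNegEvenCycleWithGeodesicDiameter Γ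
    descend {u} {v} {p} {q} (acc shorter) d
      with Any.any? (λ x → x ∈? q ×-dec ¬? (x Fin.≟ u) ×-dec ¬? (x Fin.≟ v)) p
    ... | yes common
      with x , x∈p , x∈q , x≢u , x≢v ← find common
      with _ , _ , _ , _ , d′ , p′<p ← discordant-split d x∈p x∈q x≢u x≢v = descend (shorter p′<p) d′
    ... | no none = disjoint-discordant⇒cycle d only-ends
      where
      only-ends : InternallyDisjoint u v p q
      only-ends {x} x∈p x∈q with x Fin.≟ u | x Fin.≟ v
      ... | yes x≡u | _       = inj₁ x≡u
      ... | no  _   | yes x≡v = inj₂ x≡v
      ... | no  x≢u | no  x≢v = contradiction (lose x∈p (x∈q , x≢u , x≢v)) none

  signℤ≤1 : ∀ p → signℤ Γ p ℤ.≤ ℤ.+ 1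
  signℤ≤1 p with signOf Γ p
  ... | Sign.+ = ℤ.+≤+ (s≤s z≤n)
  ... | Sign.- = ℤ.-≤+

  -1≤signℤ : ∀ p → ℤ.-1ℤ ℤ.≤ signℤ Γ p
  -1≤signℤ p with signOf Γ p
  ... | Sign.+ = ℤ.-≤+
  ... | Sign.- = ℤ.-≤- z≤n

  opposite-signs⇒¬compatible : ∀ {k} → Shortest Γ u v p → Shortest Γ u v q →
                               signOf Γ p ≡ Sign.+ → signOf Γ q ≡ Sign.- → len Γ p ≡ suc k → ¬ Compatible Γ u v
  opposite-signs⇒¬compatible {p = p} {q} {k} sp sq p+ q- len-p compatible
    with () ← compatible _ _
      (ℤ.+ 1 , suc k , ((p , sp , cong (_◃ 1) (sym p+)) , λ r _ → signℤ≤1 r) , (p , sp , len-p) , refl)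
      (ℤ.-1ℤ , suc k , ((q , sq , cong (_◃ 1) (sym q-)) , λ r _ → -1≤signℤ r) , (p , sp , len-p) , refl)

  discordant⇒¬compatible : ∀ {k} → Discordant u v p q → len Γ p ≡ suc k → ¬ Compatible Γ u v
  discordant⇒¬compatible (sp , sq , p≢q) len-p with ≢-cases p≢q
  ... | inj₁ (p+ , q-) = opposite-signs⇒¬compatible sp sq p+ q- len-p
  ... | inj₂ (p- , q+) = opposite-signs⇒¬compatible sq sp q+ p- (trans (shortest-len sq sp) len-p)

  concordant⇒compatible : ¬ ∃₂ (Discordant u v) → Compatible Γ u v
  concordant⇒compatible no-discord _ _
      (_ , _ , ((p , sp , s≡) , _) , (p′ , sp′ , d≡) , refl)
      (_ , _ , ((q , sq , s′≡) , _) , (q′ , sq′ , d′≡) , refl)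
    with signOf Γ p Sign.≟ signOf Γ q
  ... | no  p≢q = contradiction (p , q , sp , sq , p≢q) no-discord
  ... | yes p≡q = cong₂ (λ s d → s ℤ.* ℤ.+ d)
        (trans s≡ (trans (cong (_◃ 1) p≡q) (sym s′≡)))
        (trans (sym d≡) (trans (shortest-len sp′ sq′) d′≡))

  lists≤ : ℕ → List (List (Fin n))
  lists≤ zero    = [ [] ]
  lists≤ (suc m) = [] ∷ concatMap (λ x → map (x ∷_) (lists≤ m)) (allFin n)

  ∈-lists≤ : ∀ m p → length p ≤ m → p ∈ lists≤ m
  ∈-lists≤ zero    []      _         = here refl
  ∈-lists≤ (suc m) []      _         = here refl
  ∈-lists≤ (suc m) (x ∷ p) (s≤s p≤m) =
    there (∈-concatMap⁺ (λ y → map (y ∷_) (lists≤ m))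
            (Any.map (λ { refl → ∈-map⁺ (x ∷_) (∈-lists≤ m p p≤m) }) (∈-allFin x)))

  chain? : ∀ p → Dec (Chain Γ p)
  chain? []           = yes tt
  chain? (x ∷ [])     = yes tt
  chain? (x ∷ y ∷ xs) = (adj x y Bool.≟ true) ×-dec chain? (y ∷ xs)

  isPath? : ∀ u v p → Dec (IsPath Γ u v p)
  isPath? u v p = Maybe.≡-dec Fin._≟_ (head p) (just u)
           ×-dec Maybe.≡-dec Fin._≟_ (last p) (just v)
           ×-dec chain? p
           ×-dec AllPairs.allPairs? (λ x y → ¬? (x Fin.≟ y)) p

  len≤⇒length≤ : Walk a b p → Walk u v q → len Γ p ≤ len Γ q → length p ≤ length q
  len≤⇒length≤ wp wq p≤q with _ , refl ← walk⇒∷ wp | _ , refl ← walk⇒∷ wq = s≤s p≤q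

  -- Any u–v path p₀ bounds the length of shortest paths, which makes the
  -- search for a discordant pair finite.
  module _ {u v p₀} (path₀ : IsPath Γ u v p₀) where

    candidates : List (List (Fin n))
    candidates = lists≤ (length p₀)

    shortest? : ∀ p → Dec (Shortest Γ u v p)
    shortest? p with isPath? u v p | len Γ p ≤? len Γ p₀
    ... | no ¬path | _     = no λ (path , _) → ¬path path
    ... | yes _    | no ≰₀ = no λ (_ , minimal) → ≰₀ (minimal p₀ path₀)
    ... | yes path | yes ≤₀
      with All.all? (λ q → isPath? u v q →-dec (len Γ p ≤? len Γ q)) candidates
    ...   | no ¬all = no λ (_ , minimal) → ¬all (All.tabulate λ {q} _ → minimal q)
    ...   | yes all = yes (path , minimal)
      where
      minimal : ∀ q → IsPath Γ u v q → len Γ p ≤ len Γ q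
      minimal q path-q with length q ≤? length p₀
      ... | yes q≤₀ = All.lookup all (∈-lists≤ _ q q≤₀) path-q
      ... | no  q≰₀ = ≤-trans ≤₀ (∸-monoˡ-≤ 1 (<⇒≤ (≰⇒> q≰₀)))

    shortest⇒candidate : Shortest Γ u v p → p ∈ candidates
    shortest⇒candidate {p} (path , minimal) =
      ∈-lists≤ _ p (len≤⇒length≤ (path⇒walk path) (path⇒walk path₀) (minimal p₀ path₀))

    discordant? : Dec (∃₂ (Discordant u v))
    discordant? with Any.any? (λ p → Any.any? (λ q →
                       shortest? p ×-dec shortest? q ×-dec ¬? (signOf Γ p Sign.≟ signOf Γ q)) candidates) candidates
    ... | yes found with p , _ , found′ ← find found with q , _ , d ← find found′ = yes (p , q , d)
    ... | no  none  = no λ (p , q , d@(sp , sq , _)) →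
                        none (lose (shortest⇒candidate sp) (lose (shortest⇒candidate sq) d))

  closedWalk-arcs : ∀ {c i k} → Walk w w c → c ! i ≡ just u → c ! (i + k) ≡ just v →
                    ∃₂ λ p q → Walk u v p × Walk v u q × len Γ p ≡ k × len Γ c ≡ len Γ p + len Γ q
                             × signOf Γ c ≡ signOf Γ p Sign.* signOf Γ q
  closedWalk-arcs {w} {u} {v} {c} {k = k} wc c!i c!i+k
    with A , R , refl , refl ← !⇒++ c c!i
    with wA , wR ← split-walk A wc
    with B , S , R≡ , refl ← !⇒++ (u ∷ R) {k} (trans (sym (!-++ʳ A k)) c!i+k)
    with wB , wS ← split-walk B (subst (Walk u w) R≡ wR)
    with T , A≡ ← walk⇒∷ wA =
    B ++ [ v ] , (v ∷ S) ++ T , wB , wS ++ʷ subst (Walk w u) A≡ wA , len-∷ʳ B , len-c , sign-c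
    where
    open ≡-Reasoning
    len-c : len Γ (A ++ u ∷ R) ≡ len Γ (B ++ [ v ]) + len Γ ((v ∷ S) ++ T)
    len-c = begin
      len Γ (A ++ u ∷ R)                                       ≡⟨ len-split A ⟩
      len Γ (A ++ [ u ]) + len Γ (u ∷ R)                       ≡⟨ cong₂ (λ a r → len Γ a + len Γ r) A≡ R≡ ⟩
      length T + len Γ (B ++ v ∷ S)                            ≡⟨ cong (length T +_) (len-split B) ⟩
      length T + (len Γ (B ++ [ v ]) + length S)               ≡⟨ +-comm (length T) _ ⟩
      (len Γ (B ++ [ v ]) + length S) + length T               ≡⟨ +-assoc (len Γ (B ++ [ v ])) _ _ ⟩
      len Γ (B ++ [ v ]) + (length S + length T)               ≡⟨ cong (len Γ (B ++ [ v ]) +_) (len-++ʷ wS T) ⟨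
      len Γ (B ++ [ v ]) + len Γ ((v ∷ S) ++ T)                ∎
    sign-c : signOf Γ (A ++ u ∷ R) ≡ signOf Γ (B ++ [ v ]) Sign.* signOf Γ ((v ∷ S) ++ T)
    sign-c = begin
      signOf Γ (A ++ u ∷ R)                                    ≡⟨ signOf-split A ⟩
      signOf Γ (A ++ [ u ]) Sign.* signOf Γ (u ∷ R)            ≡⟨ cong₂ (λ a r → signOf Γ a Sign.* signOf Γ r) A≡ R≡ ⟩
      signOf Γ (w ∷ T) Sign.* signOf Γ (B ++ v ∷ S)            ≡⟨ cong (signOf Γ (w ∷ T) Sign.*_) (signOf-split B) ⟩
      signOf Γ (w ∷ T) Sign.* (signOf Γ (B ++ [ v ]) Sign.* signOf Γ (v ∷ S))
                                                              ≡⟨ *-rotate (signOf Γ (w ∷ T)) (signOf Γ (B ++ [ v ])) (signOf Γ (v ∷ S)) ⟩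
      signOf Γ (B ++ [ v ]) Sign.* (signOf Γ (v ∷ S) Sign.* signOf Γ (w ∷ T))
                                                              ≡⟨ cong (signOf Γ (B ++ [ v ]) Sign.*_) (signOf-++ʷ wS T) ⟨
      signOf Γ (B ++ [ v ]) Sign.* signOf Γ ((v ∷ S) ++ T)     ∎

  cycle⇒incompatible : HasNegEvenCycleWithGeodesicDiameter Γ → Incompatible Γ
  cycle⇒incompatible ([] , _ , _ , _ , _ , _ , _ , _ , () , _)
  cycle⇒incompatible (_ , zero , _ , _ , _ , (_ , _ , _ , 3≤len) , len-c , _) with () ← subst (3 ≤_) len-c 3≤len
  cycle⇒incompatible (w ∷ cs , suc k , u , v , i , (chain , closed , _ , _) , len-c , negative , c!i , c!i+k , geodesic)
    with p , q , wp , wq , len-p , len-c′ , sign-c ← closedWalk-arcs {i = i} (chain⇒walk (w ∷ cs) refl (sym closed) chain) c!i c!i+k =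
    u , v , discordant⇒¬compatible (arc-shortest wp len-p , arc-shortest (reverseʷ wq) len-q̅ , *≡-⇒≢ sign) len-p
    where
    arc-shortest : ∀ {r} → Walk u v r → len Γ r ≡ suc k → Shortest Γ u v r
    arc-shortest wr len-r = geodesic⇒shortest wr λ r′ path → subst (_≤ len Γ r′) (sym len-r) (geodesic r′ path)
    len-q̅ : len Γ (reverse q) ≡ suc k
    len-q̅ = trans (len-reverse q)
                  (+-cancelˡ-≡ (suc k) _ _ (trans (sym (trans len-c′ (cong (_+ len Γ q) len-p))) len-c))
    sign : signOf Γ p Sign.* signOf Γ (reverse q) ≡ Sign.-
    sign = trans (cong (signOf Γ p Sign.*_) (signOf-reverse wq)) (trans (sym sign-c) negative)

mainTheorem2 : (n : ℕ) (Γ : SignedGraph n) → TwoConnected Γ → NonGeodetic Γ → (Incompatible Γ ⇔ HasNegEvenCycleWithGeodesicDiameter Γ)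
mainTheorem2 n Γ (_ , connected , _) _ = mk⇔ incompatible⇒cycle (cycle⇒incompatible Γ)
  where
  incompatible⇒cycle : Incompatible Γ → HasNegEvenCycleWithGeodesicDiameter Γ
  incompatible⇒cycle (u , v , ¬compatible) with discordant? Γ (proj₂ (connected u v))
  ... | yes (_ , _ , d) = discordant⇒cycle Γ d
  ... | no  none        = contradiction (concordant⇒compatible Γ none) ¬compatible
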